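{- Any string $S$ of length $n$ over the integer alphabet $\Sigma=\{1,\ldots,\sigma\}$ whose number of runs is $\mathsf{rle}$ can be reconstructed by an adaptive algorithm with $q=O(\mathsf{rle}\,(\sigma+\log\frac{n}{\mathsf{rle}}))$ substring queries, in $O(q)$ time and $O(\mathsf{rle})$ space.
   Context: A run of $S$ is a maximal substring of $S$ consisting of repetitions of a single character; $\mathsf{rle}$ is the number of runs of $S$. A substring oracle knows the hidden string $S$ and answers queries of the form "Is $s$ a substring of $S$?" with yes/no; the algorithm may choose each query depending on previous answers, and must determine $S$ exactly. The alphabet $\Sigma$ is known to the algorithm (the length $n$ need not be). In measuring time, each query to the oracle is assumed to be submittable in constant time and space regardless of the length of the queried string. -}

module Defs where

open import Data.Bool using () renaming (if_then_else_ to ifᵇ_then_else_)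
open import Data.Empty using (⊥-elim)
open import Data.Fin using (Fin; zero; suc)
open import Data.List using (List; []; _∷_; _++_; replicate; length; concatMap)
open import Data.List.Relation.Binary.Infix.Heterogeneous using (Infix)
open import Data.List.Relation.Unary.All using (All; []; _∷_)
open import Data.List.Relation.Unary.Linked using (Linked; []; [-]; _∷_)
open import Data.Nat using (ℕ; zero; suc; _+_; _∸_; _⊔_; _≤_; s≤s; z≤n; _≟_; _<ᵇ_; _≡ᵇ_; ⌊_/2⌋)
open import Data.Product using (_×_; _,_; proj₁; proj₂; Σ-syntax)
open import Data.Vec.Functional using (Vector; updateAt)
open import Function using (const; _on_)
open import Relation.Binary.PropositionalEquality using (_≡_; _≢_; refl; cong)
open import Relation.Nullary using (¬_; yes; no)

Char String : Set
Char   = ℕ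
String = List Char

InAlphabet : ℕ → Char → Set
InAlphabet σ c = 1 ≤ c × c ≤ σ

_IsSubstringOf_ : String → String → Set
_IsSubstringOf_ = Infix _≡_

-- A run is given by its character and its length.
Run : Set
Run = Char × ℕ

power : Run → String
power (c , ℓ) = replicate ℓ c

prepend : Char → List Run → List Run
prepend c [] = (c , 1) ∷ []
prepend c ((d , ℓ) ∷ rs) with c ≟ d
... | yes _ = (d , suc ℓ) ∷ rs
... | no  _ = (c , 1) ∷ (d , ℓ) ∷ rs

runs : String → List Run
runs []      = []
runs (c ∷ s) = prepend c (runs s)

rle : String → ℕ
rle s = length (runs s)

-- `runs s` cuts s into nonempty unary blocks, each of which is maximal
-- because neighbouring blocks have different characters.

runs-concat : ∀ s → concatMap power (runs s) ≡ s
runs-concat []      = refl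
runs-concat (c ∷ s) = go (runs s) (runs-concat s)
  where
  go : ∀ rs → concatMap power rs ≡ s → concatMap power (prepend c rs) ≡ c ∷ s
  go [] refl = refl
  go ((d , ℓ) ∷ rs) refl with c ≟ d
  ... | yes refl = refl
  ... | no  _    = refl

runs-nonempty : ∀ s → All (λ r → 1 ≤ proj₂ r) (runs s)
runs-nonempty []      = []
runs-nonempty (c ∷ s) = go (runs s) (runs-nonempty s)
  where
  go : ∀ rs → All (λ r → 1 ≤ proj₂ r) rs → All (λ r → 1 ≤ proj₂ r) (prepend c rs)
  go [] [] = s≤s z≤n ∷ []
  go ((d , ℓ) ∷ rs) (p ∷ ps) with c ≟ d
  ... | yes _ = s≤s z≤n ∷ ps
  ... | no  _ = s≤s z≤n ∷ p ∷ ps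

runs-maximal : ∀ s → Linked (_≢_ on proj₁) (runs s)
runs-maximal []      = []
runs-maximal (c ∷ s) = go (runs s) (runs-maximal s)
  where
  relabel : ∀ {d ℓ ℓ′ rs} → Linked (_≢_ on proj₁) ((d , ℓ) ∷ rs) → Linked (_≢_ on proj₁) ((d , ℓ′) ∷ rs)
  relabel [-]      = [-]
  relabel (p ∷ ps) = p ∷ ps

  go : ∀ rs → Linked (_≢_ on proj₁) rs → Linked (_≢_ on proj₁) (prepend c rs)
  go [] _ = [-]
  go ((d , ℓ) ∷ rs) ps with c ≟ d
  ... | yes _  = relabel ps
  ... | no c≢d = c≢d ∷ ps

data Operand (k : ℕ) : Set where
  reg : Fin k → Operand k
  lit : ℕ → Operand k

data Op : Set where
  add sub shr less : Op

shiftʳ : ℕ → ℕ → ℕ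
shiftʳ x zero    = x
shiftʳ x (suc i) = ⌊ shiftʳ x i /2⌋

⟦_⟧ : Op → ℕ → ℕ → ℕ
⟦ add  ⟧ x y = x + y
⟦ sub  ⟧ x y = x ∸ y
⟦ shr  ⟧ x y = shiftʳ x y
⟦ less ⟧ x y = ifᵇ x <ᵇ y then 1 else 0

infixr 5 _⨾_

-- Programs of a word RAM with k registers and a substring oracle.  The first
-- register of `set`, `load` and `query` is the destination; tests succeed on nonzero
-- words.
data Program (k : ℕ) : Set where
  set            : Fin k → Op → Operand k → Operand k → Program k
  load           : Fin k → (address : Operand k) → Program k
  store          : (address value : Operand k) → Program k
  query          : Fin k → (pointer : Operand k) → Program k
  _⨾_            : Program k → Program k → Program k
  if_then_else_  : Operand k → Program k → Program k → Program k
  while_loop_    : Operand k → Program k → Program k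

Memory : Set
Memory = ℕ → ℕ

write : ℕ → ℕ → Memory → Memory
write a v m b = ifᵇ b ≡ᵇ a then v else m b

record State (k : ℕ) : Set where
  constructor ⟨_,_⟩
  field
    regs : Vector ℕ k
    mem  : Memory

open State public

-- The only input is σ: neither the hidden string nor its length is
-- available other than through queries.
initial : ∀ k → ℕ → State (suc k)
initial k σ = ⟨ (λ { zero → σ ; (suc _) → 0 }) , const 0 ⟩

setReg : ∀ {k} → Fin k → ℕ → State k → State k
setReg r v s = record s { regs = updateAt (regs s) r (const v) }

setMem : ∀ {k} → ℕ → ℕ → State k → State k
setMem a v s = record s { mem = write a v (mem s) }

value : ∀ {k} → Operand k → State k → ℕ
value (reg r) s = regs s r
value (lit n) s = n

-- Strings are handed over, both to the oracle and as the output, by a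
-- pointer to a linked list of powers c^ℓ.  A node at address suc p occupies
-- three cells: character, exponent, pointer to the next node (0 = none).
-- Being finite, a derivation of `Spells` excludes cyclic lists.
data Spells (m : Memory) : ℕ → String → Set where
  nil  : Spells m 0 []
  node : ∀ {p w} → Spells m (m (3 + p)) w → Spells m (suc p) (power (m (1 + p) , m (2 + p)) ++ w)

record Cost : Set where
  constructor cost
  field
    queries : ℕ
    time    : ℕ
    cells   : ℕ  -- memory size: one more than the largest address used
    word    : ℕ  -- largest word written to a register or to memory

open Cost public

infixr 5 _⊕_

_⊕_ : Cost → Cost → Cost
cost q t c w ⊕ cost q′ t′ c′ w′ = cost (q + q′) (t + t′) (c ⊔ c′) (w ⊔ w′)

tick : Cost
tick = cost 0 1 0 0

-- Exec S P s s′ κ: started in s with hidden string S, the program P halts in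
-- s′ at cost κ.  A query takes one time unit and no memory besides its list.
data Exec {k} (S : String) : Program k → State k → State k → Cost → Set where

  exec-set : ∀ {r o x y s} → let v = ⟦ o ⟧ (value x s) (value y s) in
    Exec S (set r o x y) s (setReg r v s) (cost 0 1 0 v)

  exec-load : ∀ {r x s} → let a = value x s in
    Exec S (load r x) s (setReg r (mem s a) s) (cost 0 1 (suc a) (mem s a))

  exec-store : ∀ {x y s} → let a = value x s ; v = value y s in
    Exec S (store x y) s (setMem a v s) (cost 0 1 (suc a) v)

  exec-query-yes : ∀ {r x s w} → Spells (mem s) (value x s) w → w IsSubstringOf S →
    Exec S (query r x) s (setReg r 1 s) (cost 1 1 0 1)

  exec-query-no : ∀ {r x s w} → Spells (mem s) (value x s) w → ¬ (w IsSubstringOf S) →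
    Exec S (query r x) s (setReg r 0 s) (cost 1 1 0 0)

  exec-⨾ : ∀ {P Q s s′ s″ κ κ′} → Exec S P s s′ κ → Exec S Q s′ s″ κ′ →
    Exec S (P ⨾ Q) s s″ (κ ⊕ κ′)

  exec-then : ∀ {x P Q s s′ κ} → value x s ≢ 0 → Exec S P s s′ κ →
    Exec S (if x then P else Q) s s′ (tick ⊕ κ)

  exec-else : ∀ {x P Q s s′ κ} → value x s ≡ 0 → Exec S Q s s′ κ →
    Exec S (if x then P else Q) s s′ (tick ⊕ κ)

  exec-done : ∀ {x P s} → value x s ≡ 0 →
    Exec S (while x loop P) s s tick

  exec-loop : ∀ {x P s s′ s″ κ κ′} → value x s ≢ 0 →
    Exec S P s s′ κ → Exec S (while x loop P) s′ s″ κ′ →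
    Exec S (while x loop P) s s″ (tick ⊕ κ ⊕ κ′)

-- Executions are deterministic, so "some execution of P from s" is the same
-- as "the execution of P from s".

spells-unique : ∀ {m p w w′} → Spells m p w → Spells m p w′ → w ≡ w′
spells-unique nil      nil      = refl
spells-unique (node d) (node e) = cong (_ ++_) (spells-unique d e)

exec-unique : ∀ {k S} {P : Program k} {s s₁ s₂ κ₁ κ₂} →
  Exec S P s s₁ κ₁ → Exec S P s s₂ κ₂ → s₁ ≡ s₂ × κ₁ ≡ κ₂
exec-unique exec-set exec-set = refl , refl
exec-unique exec-load exec-load = refl , refl
exec-unique exec-store exec-store = refl , refl
exec-unique (exec-query-yes _ _) (exec-query-yes _ _) = refl , refl
exec-unique (exec-query-yes l i) (exec-query-no l′ ¬i) with refl ← spells-unique l l′ = ⊥-elim (¬i i)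
exec-unique (exec-query-no l ¬i) (exec-query-yes l′ i) with refl ← spells-unique l l′ = ⊥-elim (¬i i)
exec-unique (exec-query-no _ _) (exec-query-no _ _) = refl , refl
exec-unique (exec-⨾ d e) (exec-⨾ d′ e′)
  with refl , refl ← exec-unique d d′ with refl , refl ← exec-unique e e′ = refl , refl
exec-unique (exec-then _ d) (exec-then _ d′) with refl , refl ← exec-unique d d′ = refl , refl
exec-unique (exec-then n _) (exec-else z _) = ⊥-elim (n z)
exec-unique (exec-else z _) (exec-then n _) = ⊥-elim (n z)
exec-unique (exec-else _ d) (exec-else _ d′) with refl , refl ← exec-unique d d′ = refl , refl
exec-unique (exec-done _) (exec-done _) = refl , refl
exec-unique (exec-done z) (exec-loop n _ _) = ⊥-elim (n z)
exec-unique (exec-loop n _ _) (exec-done z) = ⊥-elim (n z)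
exec-unique (exec-loop _ d e) (exec-loop _ d′ e′)
  with refl , refl ← exec-unique d d′ with refl , refl ← exec-unique e e′ = refl , refl

-- P started with σ and hidden string S halts at cost κ with a pointer to S in
-- its first register.
Reconstructs : ∀ {k} → Program (suc k) → ℕ → String → Cost → Set
Reconstructs {k} P σ S κ = Σ[ s ∈ State (suc k) ]
  Exec S P (initial k σ) s κ × Spells (mem s) (regs s zero) S

-- Registers count as memory too.
space : ∀ {k} → Program k → Cost → ℕ
space {k} _ κ = k + cells κ

{-# OPTIONS --safe #-}

-- Maintain a substring T of S.  For a character c, let e be the largest exponent
-- for which T c^e still occurs in S; it is found by doubling and bisection with
-- O(1 + log e) queries.  If e > 0, then T c^e becomes the new T; by maximality no
-- occurrence of it is followed by another c, so the next run has a different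
-- character.  If e = 0 for all c, then T is a suffix of S, and the same search to
-- the left ends with T = S.
-- Each run costs at most σ + O(1 + log e) queries, and Σ log e ≤ rle (log (n / rle) + O(1)).
--
-- Empty powers are allowed in linked lists.  So the list of T always contains a
-- spare node, the slot, at the end being extended, and c^e is tried out in it.

module Submission where

open import Data.Bool using (true; false; T)
open import Data.Empty using (⊥-elim)
open import Data.Fin.Patterns
open import Data.List using (List; []; _∷_; _++_; _∷ʳ_; replicate; length; concatMap; head; last; initLast; _∷ʳ′_)
open import Data.List.Properties using (++-assoc; ++-identityʳ; concatMap-++; length-++; length-replicate)
open import Data.List.Relation.Binary.Infix.Heterogeneous using (_++ⁱ_; toView; fromView; MkView)
import Data.List.Relation.Binary.Infix.Heterogeneous.Properties as Infixₚ
open import Data.List.Relation.Binary.Pointwise using (Pointwise-≡⇒≡; ≡⇒Pointwise-≡)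
open import Data.List.Relation.Unary.All using (All; []; _∷_)
import Data.List.Relation.Unary.All.Properties as Allₚ
open import Data.List.Relation.Unary.Linked using (Linked; []; [-]; _∷_)
import Data.List.Relation.Unary.Linked.Properties as Linkedₚ
open import Data.Maybe using (just; nothing)
open import Data.Maybe.Relation.Binary.Connected using (Connected; just; nothing-just)
open import Data.Nat using (ℕ; zero; suc; _+_; _*_; _∸_; _^_; _/_; _%_; _≤_; _<_; z≤n; s≤s; _≟_; _≡ᵇ_; ⌊_/2⌋; NonZero; >-nonZero; >-nonZero⁻¹)
open import Data.Nat.DivMod using (m≡m%n+[m/n]*n; m%n<n)
open import Data.Nat.Logarithm using (⌊log₂_⌋; ⌊log₂⌋-mono-≤; ⌊log₂[2^n]⌋≡n)
open import Data.Nat.Properties hiding (_≟_)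
open import Data.Nat.Tactic.RingSolver using (solve-∀)
open import Data.Product using (_×_; _,_; proj₁; proj₂; Σ-syntax; ∃-syntax; ∃₂)
open import Data.Sum using (_⊎_; inj₁; inj₂)
open import Data.Unit using (tt)
open import Defs
open import Function using (_on_; case_of_)
open import Relation.Binary.PropositionalEquality using (_≡_; _≢_; refl; sym; trans; cong; cong₂; subst)
open import Relation.Nullary using (¬_; yes; no; Dec)

-- Substrings and their occurrences.

infix 4 _⊑_

_⊑_ : String → String → Set
_⊑_ = _IsSubstringOf_

-- This decision plays the oracle: building an execution of `query` requires knowing which of its
-- two rules applies.
_⊑?_ : ∀ w s → Dec (w ⊑ s)
_⊑?_ = Infixₚ.infix? _≟_

⊑-trans : ∀ {u v w} → u ⊑ v → v ⊑ w → u ⊑ w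
⊑-trans = Infixₚ.trans trans

⊑-context : ∀ u w v → w ⊑ u ++ w ++ v
⊑-context u w v = fromView (MkView u (≡⇒Pointwise-≡ refl) v)

⊑-refl : ∀ {w} → w ⊑ w
⊑-refl = Infixₚ.fromPointwise (≡⇒Pointwise-≡ refl)

⊑-prefix : ∀ {s} w v → w ++ v ⊑ s → w ⊑ s
⊑-prefix w v = ⊑-trans (⊑-context [] w v)

⊑-suffix : ∀ {s} u w → u ++ w ⊑ s → w ⊑ s
⊑-suffix u w p = ⊑-trans (subst (λ z → w ⊑ u ++ z) (++-identityʳ w) (⊑-context u w [])) p

⊑-locate : ∀ {w s} → w ⊑ s → ∃₂ λ u v → s ≡ u ++ w ++ v
⊑-locate p with MkView u q v ← toView p with refl ← Pointwise-≡⇒≡ q = u , v , refl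

⊑-All : ∀ {P : Char → Set} {w s} → w ⊑ s → All P s → All P w
⊑-All {w = w} p a with u , v , refl ← ⊑-locate p = Allₚ.++⁻ˡ w (Allₚ.++⁻ʳ u a)

replicate-shift : ∀ n (c : Char) w → replicate n c ++ c ∷ w ≡ c ∷ replicate n c ++ w
replicate-shift zero    c w = refl
replicate-shift (suc n) c w = cong (c ∷_) (replicate-shift n c w)

-- Run lists, and the number of runs of a substring.

last-∷ʳ : ∀ (rs : List Run) r → last (rs ∷ʳ r) ≡ just r
last-∷ʳ []            r = refl
last-∷ʳ (_ ∷ [])      r = refl
last-∷ʳ (_ ∷ s ∷ rs) r = last-∷ʳ (s ∷ rs) r

cat : List Run → String
cat = concatMap power

-- The head comparison makes the relation stable under prepending a common character.
data _≼_ : List Run → List Run → Set where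
  []   : ∀ {rs} → [] ≼ rs
  same : ∀ {c k l rs rs′} → length rs ≤ length rs′ → ((c , k) ∷ rs) ≼ ((c , l) ∷ rs′)

≼-length : ∀ {rs rs′} → rs ≼ rs′ → length rs ≤ length rs′
≼-length []       = z≤n
≼-length (same p) = s≤s p

prepend-mono : ∀ c {rs rs′} → rs ≼ rs′ → prepend c rs ≼ prepend c rs′
prepend-mono c {rs′ = []} [] = same z≤n
prepend-mono c {rs′ = (d , _) ∷ _} [] with c ≟ d
... | yes refl = same z≤n
... | no  _    = same z≤n
prepend-mono c (same {d} p) with c ≟ d
... | yes refl = same p
... | no  _    = same (s≤s p)

runs-prefix : ∀ w v → runs w ≼ runs (w ++ v)
runs-prefix []      v = []
runs-prefix (c ∷ w) v = prepend-mono c (runs-prefix w v)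

length-prepend : ∀ c rs → length rs ≤ length (prepend c rs)
length-prepend c [] = z≤n
length-prepend c ((d , _) ∷ rs) with c ≟ d
... | yes _ = ≤-refl
... | no  _ = n≤1+n _

rle-suffix : ∀ u w → rle w ≤ rle (u ++ w)
rle-suffix []      w = ≤-refl
rle-suffix (c ∷ u) w = ≤-trans (rle-suffix u w) (length-prepend c (runs (u ++ w)))

-- Letters removed in front only undo `prepend` steps, and letters removed at the end are handled by
-- `_≼_`. Together with `runs-cat` this bounds the number of committed runs, and hence the memory,
-- by `rle S`.
rle-mono : ∀ {w s} → w ⊑ s → rle w ≤ rle s
rle-mono {w} p with u , v , refl ← ⊑-locate p =
  ≤-trans (≼-length (runs-prefix w v)) (rle-suffix u (w ++ v))

IsRunList : List Run → Set
IsRunList rs = Linked (_≢_ on proj₁) rs × All (λ r → 1 ≤ proj₂ r) rs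

relabel : ∀ {c k l} {rs : List Run} → Linked (_≢_ on proj₁) ((c , k) ∷ rs) → Linked (_≢_ on proj₁) ((c , l) ∷ rs)
relabel [-]      = [-]
relabel (p ∷ ps) = p ∷ ps

-- Recursion on the exponents: a block of at least two letters loses one that `prepend` merges back,
-- and a block of one letter is kept apart because its neighbour has a different character.
runs-cat : ∀ {rs} → IsRunList rs → runs (cat rs) ≡ rs
runs-cat {[]} _ = refl
runs-cat {(_ , zero) ∷ _} (_ , () ∷ _)
runs-cat {(c , suc zero) ∷ []} _ = refl
runs-cat {(c , suc zero) ∷ (d , l) ∷ rs} (c≢d ∷ ls , _ ∷ ps) rewrite runs-cat (ls , ps) with c ≟ d
... | yes c≡d = ⊥-elim (c≢d c≡d)
... | no  _   = refl
runs-cat {(c , suc (suc k)) ∷ rs} (ls , _ ∷ ps) rewrite runs-cat {(c , suc k) ∷ rs} (relabel ls , s≤s z≤n ∷ ps) with c ≟ c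
... | yes _   = refl
... | no  c≢c = ⊥-elim (c≢c refl)

-- Invariants of the search to the right and to the left.

-- The state of the search in either direction: the committed runs `rs` spell a
-- substring of S that cannot be extended by repeating its border characters.
record Rightward (S : String) (rs : List Run) : Set where
  field
    isRunList : IsRunList rs
    occurs    : cat rs ⊑ S
    ¬last     : ∀ r → last rs ≡ just r → ¬ (cat rs ∷ʳ proj₁ r ⊑ S)
    ¬head     : ∀ r → head rs ≡ just r → ¬ (proj₁ r ∷ cat rs ⊑ S)

record Leftward (S : String) (rs : List Run) : Set where
  field
    isRunList : IsRunList rs
    occurs    : cat rs ⊑ S
    ¬head     : ∀ r → head rs ≡ just r → ¬ (proj₁ r ∷ cat rs ⊑ S)
    ¬snoc     : ∀ x → ¬ (cat rs ∷ʳ x ⊑ S)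

cat-∷ʳ : ∀ rs r → cat (rs ∷ʳ r) ≡ cat rs ++ power r ++ []
cat-∷ʳ rs r = concatMap-++ power rs (r ∷ [])

rightward-[] : ∀ S → Rightward S []
rightward-[] S = record
  { isRunList = [] , []
  ; occurs    = fromView (MkView [] (≡⇒Pointwise-≡ refl) S)
  ; ¬last     = λ _ ()
  ; ¬head     = λ _ ()
  }

-- The failure at `2 + e` becomes the new `¬last`, while the old `¬last` shows that `c` differs from
-- the previous character. `¬head` is inherited, except for the first run, where both borders belong
-- to the same block.
rightward-∷ʳ : ∀ {S rs c e} → Rightward S rs →
  cat rs ++ replicate (suc e) c ++ [] ⊑ S → ¬ (cat rs ++ replicate (2 + e) c ++ [] ⊑ S) →
  Rightward S (rs ∷ʳ (c , suc e))
rightward-∷ʳ {S} {rs} {c} {e} inv yes-e no-e = record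
  { isRunList = Linkedₚ.++⁺ (proj₁ isRunList) (connected (last rs) refl) [-]
              , Allₚ.++⁺ (proj₂ isRunList) (s≤s z≤n ∷ [])
  ; occurs    = subst (_⊑ S) (sym (cat-∷ʳ rs _)) yes-e
  ; ¬last     = λ r eq p → no-e (case trans (sym (last-∷ʳ rs _)) eq of λ { refl →
                  subst (_⊑ S) (trans (cong (_∷ʳ c) (cat-∷ʳ rs _)) snoc-run) p })
  ; ¬head     = no-head rs refl
  }
  where
  open Rightward inv

  connected : ∀ m → last rs ≡ m → Connected (_≢_ on proj₁) m (just (c , suc e))
  connected nothing  _  = nothing-just
  connected (just r) eq = just λ { refl → ¬last r eq
    (⊑-prefix (cat rs ∷ʳ c) (replicate e c ++ []) (subst (_⊑ S) (sym (++-assoc (cat rs) (c ∷ []) _)) yes-e)) }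

  snoc-run : (cat rs ++ replicate (suc e) c ++ []) ∷ʳ c ≡ cat rs ++ replicate (2 + e) c ++ []
  snoc-run = trans (++-assoc (cat rs) _ _) (cong (cat rs ++_)
    (trans (++-assoc (replicate (suc e) c) [] _) (replicate-shift (suc e) c [])))

  no-head : ∀ rs′ → rs′ ≡ rs → ∀ r → head (rs′ ∷ʳ (c , suc e)) ≡ just r → ¬ (proj₁ r ∷ cat (rs′ ∷ʳ (c , suc e)) ⊑ S)
  no-head []       refl _ refl p = no-e p
  no-head (r ∷ _) refl _ refl p = ¬head r refl
    (⊑-prefix (proj₁ r ∷ cat rs) _ (subst (λ z → proj₁ r ∷ z ⊑ S) (cat-∷ʳ rs _) p))

leftward-∷ : ∀ {S rs c e} → Leftward S rs →
  replicate (suc e) c ++ cat rs ⊑ S → ¬ (replicate (2 + e) c ++ cat rs ⊑ S) →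
  Leftward S ((c , suc e) ∷ rs)
leftward-∷ {S} {rs} {c} {e} inv yes-e no-e = record
  { isRunList = linked rs refl (proj₁ isRunList) , s≤s z≤n ∷ proj₂ isRunList
  ; occurs    = yes-e
  ; ¬head     = λ { _ refl → no-e }
  ; ¬snoc     = λ x p → ¬snoc x (⊑-suffix (replicate (suc e) c) _
                  (subst (_⊑ S) (++-assoc (replicate (suc e) c) (cat rs) _) p))
  }
  where
  open Leftward inv

  linked : ∀ rs′ → rs′ ≡ rs → Linked (_≢_ on proj₁) rs → Linked (_≢_ on proj₁) ((c , suc e) ∷ rs′)
  linked []      refl _  = [-]
  linked (r ∷ _) refl ls = (λ { refl → ¬head r refl
    (⊑-suffix (replicate e c) _ (subst (_⊑ S) (sym (replicate-shift e c (cat rs))) yes-e)) }) ∷ ls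

-- The handover between the phases. `¬head`, carried along since the first run, now guarantees that
-- a run put in front has a new character.
rightward⇒leftward : ∀ {S rs} → Rightward S rs → (∀ x → ¬ (cat rs ∷ʳ x ⊑ S)) → Leftward S rs
rightward⇒leftward inv ¬snoc = record { Rightward inv ; ¬snoc = ¬snoc }

-- Around an occurrence of `cat rs`, a letter to its right would contradict `¬snoc` and a letter to
-- its left would contradict `¬cons`, so nothing surrounds it.
leftward-complete : ∀ {S rs} → Leftward S rs → (∀ x → ¬ (x ∷ cat rs ⊑ S)) → S ≡ cat rs
leftward-complete {rs = rs} inv ¬cons with ⊑-locate (Leftward.occurs inv)
... | u , x ∷ v , refl = ⊥-elim (Leftward.¬snoc inv x
        (⊑-prefix (cat rs ∷ʳ x) v (subst (_⊑ u ++ cat rs ++ x ∷ v) (sym (++-assoc (cat rs) (x ∷ []) v))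
          (u ++ⁱ ⊑-refl))))
... | u , [] , refl with initLast u
... | [] = ++-identityʳ (cat rs)
... | u′ ∷ʳ′ x = ⊥-elim (¬cons x (subst (x ∷ cat rs ⊑_) (sym (++-assoc u′ (x ∷ []) _)) (⊑-context u′ (x ∷ cat rs) [])))

-- Memory writes and segments of linked lists.

write-same : ∀ a v m → write a v m a ≡ v
write-same a v m with a ≡ᵇ a in eq
... | true  = refl
... | false = ⊥-elim (subst T eq (≡⇒≡ᵇ a a refl))

write-other : ∀ {a b} v m → b ≢ a → write a v m b ≡ m b
write-other {a} {b} v m b≢a with b ≡ᵇ a in eq
... | true  = ⊥-elim (b≢a (≡ᵇ⇒≡ b a (subst T (sym eq) tt)))
... | false = refl

-- A segment of a linked list in the cells below b, from the node at p up to the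
-- pointer q.
data Path (m : Memory) (b : ℕ) : ℕ → String → ℕ → Set where
  []   : ∀ {p} → Path m b p [] p
  node : ∀ {p c ℓ p′ w q} → 3 + p < b → m (1 + p) ≡ c → m (2 + p) ≡ ℓ → m (3 + p) ≡ p′ →
    Path m b p′ w q → Path m b (suc p) (power (c , ℓ) ++ w) q

-- This is the purpose of the bound `b`: the slot lies beyond all committed nodes, so trying out
-- exponents in it leaves their segments intact.
path-agree : ∀ {m m′ b b′ p w q} → b ≤ b′ → (∀ a → a < b → m′ a ≡ m a) → Path m b p w q → Path m′ b′ p w q
path-agree b≤b′ eq []                    = []
path-agree b≤b′ eq (node {p} lt c ℓ n π) = node (≤-trans lt b≤b′)
  (trans (eq _ (m+n≤o⇒n≤o 2 lt)) c) (trans (eq _ (m+n≤o⇒n≤o 1 lt)) ℓ) (trans (eq _ lt) n) (path-agree b≤b′ eq π)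

path-++ : ∀ {m b p q r w w′} → Path m b p w q → Path m b q w′ r → Path m b p (w ++ w′) r
path-++ []                              ρ = ρ
path-++ (node {c = c} {ℓ} lt e₁ e₂ e₃ π) ρ =
  subst (λ w → Path _ _ _ w _) (sym (++-assoc (replicate ℓ c) _ _)) (node lt e₁ e₂ e₃ (path-++ π ρ))

path-spells : ∀ {m b p w} → Path m b p w 0 → Spells m p w
path-spells []                         = nil
path-spells (node _ refl refl refl π) = node (path-spells π)

path-start : ∀ {m b p w q} → q ≤ b → Path m b p w q → p ≤ b
path-start q≤b []                = q≤b
path-start q≤b (node lt _ _ _ _) = m+n≤o⇒n≤o 3 lt

-- The program and the layout of its memory.

pattern rσ = 0F
pattern rH = 1F
pattern rA = 2F
pattern rC = 3F
pattern rE = 4F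
pattern rD = 5F
pattern rX = 6F
pattern rY = 7F

-- H is the head of the list and A its slot, a node in which a character C and
-- an exponent are tried out; X points to the exponent of the slot, E is an exponent
-- known to occur and E + D the one being probed, which bounds E once it fails.
probe gallop bisect search extendʳ extendˡ : Program 8

probe =
  set rY add (reg rE) (reg rD) ⨾
  store (reg rX) (reg rY) ⨾
  query rY (reg rH)

gallop = while reg rY loop
  -- From `E = 0` and `D = 1` on, `E + 1 = D` is always a power of two, so that the bisection can
  -- halve `D` without remainder.
  ( set rE add (reg rE) (reg rD) ⨾
    set rD add (reg rD) (reg rD) ⨾
    probe )

bisect = while reg rY loop
  ( set rD shr (reg rD) (lit 1) ⨾
    probe ⨾
    -- Adding 0 stands for doing nothing, as there is no empty program.
    (if reg rY then set rE add (reg rE) (reg rD) else set rE add (reg rE) (lit 0)) ⨾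
    -- For the positive `D` occurring here, this is zero exactly when the gap has shrunk to 1.
    set rY sub (reg rD) (lit 1) )

search =
  store (reg rA) (reg rC) ⨾
  set rX add (reg rA) (lit 1) ⨾
  set rE add (lit 0) (lit 0) ⨾
  set rD add (lit 1) (lit 0) ⨾
  probe ⨾
  gallop ⨾
  set rY sub (reg rD) (lit 1) ⨾
  bisect ⨾
  -- The last probe may have left a rejected exponent in the slot. If `E` is zero, the slot becomes
  -- an empty power again.
  store (reg rX) (reg rE)

extendʳ =
  set rX add (reg rA) (lit 2) ⨾
  set rA add (reg rA) (lit 3) ⨾
  store (reg rX) (reg rA)

extendˡ =
  set rA add (reg rA) (lit 3) ⨾
  set rX add (reg rA) (lit 2) ⨾
  store (reg rX) (reg rH) ⨾
  set rH add (reg rA) (lit 0)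

scan phase : Program 8 → Program 8

scan extend = while reg rC loop
  ( search ⨾
    -- A success makes all characters candidates again, so `C` reaches 0 only after every character
    -- has failed for the same string.
    (if reg rE then extend ⨾ set rC add (reg rσ) (lit 0) else set rC sub (reg rC) (lit 1)) )

phase extend = set rC add (reg rσ) (lit 0) ⨾ scan extend

reconstruct : Program 8
reconstruct =
  set rH add (lit 1) (lit 0) ⨾
  set rA add (lit 1) (lit 0) ⨾
  phase extendʳ ⨾
  -- The slot at the right end stays in the list as an empty power, and a new slot is opened in
  -- front.
  extendˡ ⨾
  phase extendˡ ⨾
  set rσ add (reg rH) (lit 0)

-- The contents of the slot are left open, so the layout survives the probes. Nodes are allocated
-- upwards whichever end grows, hence all committed nodes lie below the slot and everything above it
-- is untouched.
record Layout (s : State 8) (p : ℕ) (L R : String) : Set where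
  field
    slot   : regs s rA ≡ suc p
    before : Path (mem s) (suc p) (regs s rH) L (suc p)
    after  : Path (mem s) (suc p) (mem s (3 + p)) R 0
    fresh  : ∀ a → 3 + p < a → mem s a ≡ 0

-- The memory `m` is arbitrary so that this serves the probed list, the list taken over by
-- `run-extendˡ`, and the output, where the slot has exponent 0.
layout-path : ∀ {s p L R m c e} → Layout s p L R → (∀ a → a ≤ p → m a ≡ mem s a) →
  m (1 + p) ≡ c → m (2 + p) ≡ e → m (3 + p) ≡ mem s (3 + p) →
  Path m (4 + p) (regs s rH) (L ++ power (c , e) ++ R) 0
layout-path {p = p} l eq c≡ e≡ next≡ = path-++
  (path-agree (m≤n+m (suc p) 3) (λ a lt → eq a (≤-pred lt)) before)
  (node ≤-refl c≡ e≡ next≡ (path-agree (m≤n+m (suc p) 3) (λ a lt → eq a (≤-pred lt)) after))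
  where open Layout l

2^+2^ : ∀ j → 2 ^ j + 2 ^ j ≡ 2 ^ suc j
2^+2^ j = cong (2 ^ j +_) (sym (+-identityʳ _))

⌊2^suc/2⌋ : ∀ j → ⌊ 2 ^ suc j /2⌋ ≡ 2 ^ j
⌊2^suc/2⌋ j = trans (cong ⌊_/2⌋ (sym (2^+2^ j))) (sym (n≡⌊n+n/2⌋ (2 ^ j)))

-- Executions within fixed memory and word bounds.

module Machine (S : String) (M W : ℕ) where

  -- Queries and time add up and are therefore tracked exactly. Cells and words combine by maximum,
  -- so it is enough to check the global bounds `M` and `W` at each step.
  record Runs (P : Program 8) (s s′ : State 8) (q t : ℕ) : Set where
    constructor runs′
    field
      {cells′ word′} : ℕ
      exec   : Exec S P s s′ (cost q t cells′ word′)
      cells≤ : cells′ ≤ M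
      word≤  : word′ ≤ W

  infixr 5 _⨟_

  _⨟_ : ∀ {P Q s s′ s″ q q′ t t′} → Runs P s s′ q t → Runs Q s′ s″ q′ t′ → Runs (P ⨾ Q) s s″ (q + q′) (t + t′)
  runs′ x c w ⨟ runs′ y c′ w′ = runs′ (exec-⨾ x y) (⊔-lub c c′) (⊔-lub w w′)

  recount : ∀ {P s s′ q q′ t t′} → q ≡ q′ → t ≡ t′ → Runs P s s′ q t → Runs P s s′ q′ t′
  recount refl refl r = r

  run-set : ∀ {r o x y s} → ⟦ o ⟧ (value x s) (value y s) ≤ W → Runs (set r o x y) s (setReg r (⟦ o ⟧ (value x s) (value y s)) s) 0 1
  run-set v≤W = runs′ exec-set z≤n v≤W

  run-store : ∀ {x y s a} → value x s ≡ a → a < M → value y s ≤ W → Runs (store x y) s (setMem (value x s) (value y s) s) 0 1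
  run-store refl a<M v≤W = runs′ exec-store a<M v≤W

  run-then : ∀ {x P Q s s′ q t} → value x s ≢ 0 → Runs P s s′ q t → Runs (if x then P else Q) s s′ q (suc t)
  run-then x≢0 (runs′ p c w) = runs′ (exec-then x≢0 p) c w

  run-else : ∀ {x P Q s s′ q t} → value x s ≡ 0 → Runs Q s s′ q t → Runs (if x then P else Q) s s′ q (suc t)
  run-else x≡0 (runs′ p c w) = runs′ (exec-else x≡0 p) c w

  run-done : ∀ {x P s} → value x s ≡ 0 → Runs (while x loop P) s s 0 1
  run-done x≡0 = runs′ (exec-done x≡0) z≤n z≤n

  run-loop : ∀ {x P s s′ s″ q q′ t t′} → value x s ≢ 0 → Runs P s s′ q t → Runs (while x loop P) s′ s″ q′ t′ →
    Runs (while x loop P) s s″ (q + q′) (suc (t + t′))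
  run-loop x≢0 (runs′ p c w) (runs′ l c′ w′) = runs′ (exec-loop x≢0 p l) (⊔-lub c c′) (⊔-lub w w′)

  -- The largest exponent by doubling and bisection.

  module Search (s₀ : State 8) {p : ℕ} {L R : String} (layout : Layout s₀ p L R)
    (p<M : 2 + p < M) (p<W : 1 + p < W) (c≤W : regs s₀ rC ≤ W) (n≤W : length S + suc (length S) ≤ W) where

    private
      n = length S
      c = regs s₀ rC

    Occurs : ℕ → Set
    Occurs e = L ++ replicate e c ++ R ⊑ S

    Answer : ℕ → ℕ → Set
    Answer b e = (b ≡ 1 × Occurs e) ⊎ (b ≡ 0 × ¬ Occurs e)

    -- What stays fixed during the probes. `E`, `D` and `Y` are left out, so a proof of `Ready`
    -- carries over unchanged when they are assigned.
    Ready : State 8 → Set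
    Ready s = regs s rσ ≡ regs s₀ rσ × regs s rH ≡ regs s₀ rH × regs s rA ≡ suc p × regs s rC ≡ c × regs s rX ≡ 2 + p
      × mem s (1 + p) ≡ c × (∀ a → a ≢ 1 + p → a ≢ 2 + p → mem s a ≡ mem s₀ a)

    occurs-≤ : ∀ {e} → Occurs e → e ≤ n
    occurs-≤ {e} o = subst (_≤ n) (length-replicate e)
      (Infixₚ.length-mono (⊑-prefix (replicate e c) R (⊑-suffix L _ o)))

    ready-store : ∀ s v → Ready s → Ready (setMem (regs s rX) v s)
    ready-store s v (σ≡ , H≡ , A≡ , C≡ , X≡ , c≡ , eq) = σ≡ , H≡ , A≡ , C≡ , X≡
      , trans (write-other v (mem s) λ e → 1+n≢n (sym (trans e X≡))) c≡
      , λ a a≢1 a≢2 → trans (write-other v (mem s) λ e → a≢2 (trans e X≡)) (eq a a≢1 a≢2)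

    probed : State 8 → ℕ → State 8
    probed s b = setReg rY b (setMem (regs s rX) (regs s rE + regs s rD) (setReg rY (regs s rE + regs s rD) s))

    ready-probed : ∀ s b → Ready s → Ready (probed s b)
    ready-probed s b r = ready-store s (regs s rE + regs s rD) r

    run-probe : ∀ s → Ready s → 1 ≤ W → regs s rE + regs s rD ≤ W →
      Σ[ b ∈ ℕ ] Runs probe s (probed s b) 1 3 × Answer b (regs s rE + regs s rD)
    run-probe s r@(_ , H≡ , _ , _ , X≡ , _) 1≤W v≤W
      with ready-store s (regs s rE + regs s rD) r
    ... | (_ , _ , _ , _ , _ , c≡ , eq) = answer ((L ++ replicate v c ++ R) ⊑? S)
      where
      v = regs s rE + regs s rD
      m = mem (probed s 0)

      list : Spells m (regs s rH) (L ++ replicate v c ++ R)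
      list = subst (λ h → Spells m h (L ++ replicate v c ++ R)) (sym H≡) (path-spells (layout-path layout
        (λ a a≤p → eq a (<⇒≢ (s≤s a≤p)) (<⇒≢ (s≤s (m≤n⇒m≤1+n a≤p)))) c≡
        (trans (cong m (sym X≡)) (write-same (regs s rX) v (mem s)))
        (eq (3 + p) (λ ()) (λ ()))))

      answer : _ → _
      answer (yes o) = 1 , (run-set v≤W ⨟ run-store X≡ p<M v≤W ⨟ runs′ (exec-query-yes list o) z≤n 1≤W) , inj₁ (refl , o)
      answer (no ¬o) = 0 , (run-set v≤W ⨟ run-store X≡ p<M v≤W ⨟ runs′ (exec-query-no list ¬o) z≤n z≤n) , inj₂ (refl , ¬o)

    ready-layout : ∀ s → Ready s → Layout s p L R
    ready-layout s (_ , H≡ , A≡ , _ , _ , _ , eq) = record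
      { slot   = A≡
      ; before = subst (λ h → Path (mem s) (suc p) h L (suc p)) (sym H≡) (path-agree ≤-refl unchanged before)
      ; after  = subst (λ q → Path (mem s) (suc p) q R 0) (sym (eq (3 + p) (λ ()) (λ ()))) (path-agree ≤-refl unchanged after)
      ; fresh  = λ a lt → trans (eq a (>⇒≢ (m+n≤o⇒n≤o 2 lt)) (>⇒≢ (m+n≤o⇒n≤o 1 lt))) (fresh a lt)
      }
      where
      open Layout layout
      unchanged : ∀ a → a < suc p → mem s a ≡ mem s₀ a
      unchanged a lt = eq a (<⇒≢ lt) (<⇒≢ (m≤n⇒m≤1+n lt))

    record Galloped (s : State 8) (j : ℕ) : Set where
      field
        {state}   : State 8
        rounds    : ℕ
        execution : Runs gallop s state rounds (rounds * 6 + 1)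
        ready     : Ready state
        E≡        : suc (regs state rE) ≡ 2 ^ (rounds + j)
        D≡        : regs state rD ≡ 2 ^ (rounds + j)
        found     : Occurs (regs state rE)
        bounded   : ¬ Occurs (regs state rE + regs state rD)

    -- Each success raises `E` by `D`, which is at least 1, and an exponent that occurs is at most
    -- `n`; so `fuel` cannot run out before a probe fails.
    run-gallop : ∀ fuel s j → n < fuel + regs s rE → Ready s → suc (regs s rE) ≡ 2 ^ j → regs s rD ≡ 2 ^ j →
      Occurs (regs s rE) → Answer (regs s rY) (regs s rE + regs s rD) → Galloped s j
    run-gallop fuel s j lt r E≡ D≡ o (inj₂ (Y≡ , ¬o)) = record
      { rounds = 0 ; execution = run-done Y≡ ; ready = r ; E≡ = E≡ ; D≡ = D≡ ; found = o ; bounded = ¬o }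
    run-gallop zero s j lt r E≡ D≡ o (inj₁ _) = ⊥-elim (<⇒≱ lt (occurs-≤ o))
    run-gallop (suc fuel) s j lt r E≡ D≡ o (inj₁ (Y≡ , o′)) = record
      { rounds    = suc rounds
      ; execution = run-loop (λ y≡0 → 0≢1+n (trans (sym y≡0) Y≡))
          (run-set E′≤W ⨟ run-set D′≤W ⨟ proj₁ (proj₂ attempt)) execution
      ; ready     = ready
      ; E≡        = trans E≡′ (cong (2 ^_) (+-suc rounds j))
      ; D≡        = trans D≡′ (cong (2 ^_) (+-suc rounds j))
      ; found     = found
      ; bounded   = bounded
      }
      where
      E′ = regs s rE + regs s rD
      D′ = regs s rD + regs s rD

      s₁ : State 8
      s₁ = setReg rD D′ (setReg rE E′ s)

      1+E≡D : suc (regs s rE) ≡ regs s rD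
      1+E≡D = trans E≡ (sym D≡)

      D′≡1+E′ : D′ ≡ suc E′
      D′≡1+E′ = cong (_+ regs s rD) (sym 1+E≡D)

      E′≤n : E′ ≤ n
      E′≤n = occurs-≤ o′

      D′≤1+n : D′ ≤ suc n
      D′≤1+n = subst (_≤ suc n) (sym D′≡1+E′) (s≤s E′≤n)

      D′≤W : D′ ≤ W
      D′≤W = ≤-trans D′≤1+n (m+n≤o⇒n≤o n n≤W)

      E′≤W : E′ ≤ W
      E′≤W = ≤-trans (≤-trans E′≤n (n≤1+n n)) (m+n≤o⇒n≤o n n≤W)

      D′≡ : D′ ≡ 2 ^ suc j
      D′≡ = trans (cong₂ _+_ D≡ D≡) (2^+2^ j)

      attempt : Σ[ b ∈ ℕ ] Runs probe s₁ (probed s₁ b) 1 3 × Answer b (E′ + D′)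
      -- The probed exponent may exceed `n`, but `E′` occurs and `D′` is its successor. This is why
      -- words up to `n + suc n` must be allowed.
      attempt = run-probe s₁ r (≤-trans (s≤s z≤n) p<W) (≤-trans (+-mono-≤ E′≤n D′≤1+n) n≤W)

      lt′ : n < fuel + E′
      lt′ = ≤-trans lt (≤-reflexive (trans (sym (+-suc fuel (regs s rE))) (cong (fuel +_) (+-comm 1 (regs s rE))))
        ∙≤ +-monoʳ-≤ fuel (+-monoʳ-≤ (regs s rE) (≤-trans (s≤s z≤n) (≤-reflexive 1+E≡D))))
        where _∙≤_ = ≤-trans

      rest : Galloped (probed s₁ (proj₁ attempt)) (suc j)
      rest = run-gallop fuel (probed s₁ (proj₁ attempt)) (suc j) lt′ (ready-probed s₁ (proj₁ attempt) r)
        (trans (sym D′≡1+E′) D′≡) D′≡ o′ (proj₂ (proj₂ attempt))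

      open Galloped rest renaming (E≡ to E≡′; D≡ to D≡′)

    record Bisected (s : State 8) (q : ℕ) : Set where
      field
        {state}   : State 8
        execution : Runs bisect s state q (q * 8 + 1)
        ready     : Ready state
        E≤        : regs s rE ≤ regs state rE
        found     : Occurs (regs state rE)
        bounded   : ¬ Occurs (suc (regs state rE))

    -- The invariant concerns the end points: `E` occurs and `E + D` does not. Halving a power of
    -- two preserves it with either answer, and at `D = 1` it is the desired maximality.
    run-bisect : ∀ j s → Ready s → regs s rD ≡ 2 ^ j → regs s rD ≤ suc n → regs s rY ≡ regs s rD ∸ 1 →
      Occurs (regs s rE) → ¬ Occurs (regs s rE + regs s rD) → Bisected s j
    run-bisect zero s r D≡ D≤ Y≡ o ¬o = record
      { execution = run-done (trans Y≡ (cong (_∸ 1) D≡)) ; ready = r ; E≤ = ≤-refl ; found = o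
      ; bounded = subst (λ e → ¬ Occurs e) (trans (cong (regs s rE +_) D≡) (+-comm (regs s rE) 1)) ¬o }
    run-bisect (suc j) s r D≡ D≤ Y≡ o ¬o = narrow attempt
      where
      D′ = ⌊ regs s rD /2⌋

      s₁ : State 8
      s₁ = setReg rD D′ s

      D′≡ : D′ ≡ 2 ^ j
      D′≡ = trans (cong ⌊_/2⌋ D≡) (⌊2^suc/2⌋ j)

      D≡D′+D′ : regs s rD ≡ D′ + D′
      D≡D′+D′ = trans D≡ (trans (sym (2^+2^ j)) (sym (cong₂ _+_ D′≡ D′≡)))

      D′≤1+n : D′ ≤ suc n
      D′≤1+n = ≤-trans (⌊n/2⌋≤n (regs s rD)) D≤

      D′≤W : D′ ≤ W
      D′≤W = ≤-trans D′≤1+n (m+n≤o⇒n≤o n n≤W)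

      n≤W′ : n ≤ W
      n≤W′ = m+n≤o⇒m≤o n n≤W

      Y≢0 : regs s rY ≢ 0
      Y≢0 y≡0 = <⇒≱ (≤-trans (+-mono-≤ (m^n>0 2 j) (m^n>0 2 j)) (≤-reflexive (trans (2^+2^ j) (sym D≡))))
        (m∸n≡0⇒m≤n (trans (sym Y≡) y≡0))

      attempt : Σ[ b ∈ ℕ ] Runs probe s₁ (probed s₁ b) 1 3 × Answer b (regs s rE + D′)
      attempt = run-probe s₁ r (≤-trans (s≤s z≤n) p<W) (≤-trans (+-mono-≤ (occurs-≤ o) D′≤1+n) n≤W)

      narrow : Σ[ b ∈ ℕ ] Runs probe s₁ (probed s₁ b) 1 3 × Answer b (regs s rE + D′) → Bisected s (suc j)
      narrow (b , run , inj₁ (b≡1 , o′)) = record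
        { execution = run-loop Y≢0
            (run-set D′≤W ⨟ run ⨟ run-then (λ b≡0 → 0≢1+n (trans (sym b≡0) b≡1))
              (run-set (≤-trans (occurs-≤ o′) n≤W′)) ⨟ run-set (≤-trans (m∸n≤m D′ 1) D′≤W)) execution
        ; ready = ready ; E≤ = ≤-trans (m≤m+n _ D′) E≤ ; found = found ; bounded = bounded }
        where
        s₂ = setReg rY (D′ ∸ 1) (setReg rE (regs s rE + D′) (probed s₁ b))
        open Bisected (run-bisect j s₂ (ready-probed s₁ b r) D′≡ D′≤1+n refl o′
          (subst (λ e → ¬ Occurs e) (trans (cong (regs s rE +_) D≡D′+D′) (sym (+-assoc (regs s rE) D′ D′))) ¬o))
      narrow (b , run , inj₂ (b≡0 , ¬o′)) = record
        { execution = run-loop Y≢0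
            (run-set D′≤W ⨟ run ⨟ run-else b≡0 (run-set (subst (_≤ W) (sym (+-identityʳ _)) (≤-trans (occurs-≤ o) n≤W′)))
              ⨟ run-set (≤-trans (m∸n≤m D′ 1) D′≤W)) execution
        ; ready = ready ; E≤ = ≤-trans (m≤m+n _ 0) E≤ ; found = found ; bounded = bounded }
        where
        s₂ = setReg rY (D′ ∸ 1) (setReg rE (regs s rE + 0) (probed s₁ b))
        E≡ : regs s rE ≡ regs s rE + 0
        E≡ = sym (+-identityʳ _)
        open Bisected (run-bisect j s₂ (ready-probed s₁ b r) D′≡ D′≤1+n refl (subst Occurs E≡ o)
          (subst (λ e → ¬ Occurs (e + D′)) E≡ ¬o′))

    -- One query tests the exponent 1. The doubling then asks `rounds` queries and leaves a gap of
    -- `2 ^ rounds`, which takes as many halvings. It stops with `E + 1 = 2 ^ rounds`, and the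
    -- bisection only raises `E`.
    record Searched : Set where
      field
        {state}   : State 8
        rounds    : ℕ
        execution : Runs search s₀ state (1 + (rounds + rounds)) (14 * rounds + 11)
        ready     : Ready state
        E≡        : mem state (2 + p) ≡ regs state rE
        2^rounds≤ : 2 ^ rounds ≤ suc (regs state rE)
        found     : Occurs (regs state rE)
        bounded   : ¬ Occurs (suc (regs state rE))

    abstract
      run-search : Occurs 0 → Searched
      run-search o₀ = record
        { rounds    = rounds
        ; execution = recount (queries≡ rounds) (time≡ rounds)
            ( run-store slot (≤-trans (n≤1+n _) p<M) c≤W ⨟ run-set (≤-trans (≤-reflexive X≡) p<W) ⨟ run-set z≤n ⨟ run-set 1≤W
            ⨟ proj₁ (proj₂ attempt) ⨟ Galloped.execution galloped ⨟ run-set (≤-trans (m∸n≤m (regs s₂ rD) 1) D≤W)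
            ⨟ Bisected.execution bisected ⨟ run-store (X-ready s₃ (Bisected.ready bisected)) p<M E≤W )
        ; ready     = ready-store s₃ (regs s₃ rE) (Bisected.ready bisected)
        ; E≡        = trans (cong (write (regs s₃ rX) (regs s₃ rE) (mem s₃)) (sym (X-ready s₃ (Bisected.ready bisected))))
                        (write-same (regs s₃ rX) (regs s₃ rE) (mem s₃))
        ; 2^rounds≤ = ≤-trans (≤-reflexive (trans (cong (2 ^_) (sym (+-identityʳ rounds))) (sym (Galloped.E≡ galloped)))) (s≤s (Bisected.E≤ bisected))
        ; found     = Bisected.found bisected
        ; bounded   = Bisected.bounded bisected
        }
        where
        open Layout layout

        s₁ : State 8
        s₁ = setReg rD 1 (setReg rE 0 (setReg rX (regs s₀ rA + 1) (setMem (regs s₀ rA) c s₀)))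

        X≡ : regs s₀ rA + 1 ≡ 2 + p
        X≡ = trans (cong (_+ 1) slot) (+-comm (suc p) 1)

        X-ready : ∀ s → Ready s → regs s rX ≡ 2 + p
        X-ready _ (_ , _ , _ , _ , X≡ , _) = X≡

        1≤W : 1 ≤ W
        1≤W = ≤-trans (s≤s z≤n) p<W

        ready₁ : Ready s₁
        ready₁ = refl , refl , slot , refl , X≡
          , trans (cong (write (regs s₀ rA) c (mem s₀)) (sym slot)) (write-same (regs s₀ rA) c (mem s₀))
          , λ a a≢1 _ → write-other c (mem s₀) λ e → a≢1 (trans e slot)

        attempt : Σ[ b ∈ ℕ ] Runs probe s₁ (probed s₁ b) 1 3 × Answer b 1
        attempt = run-probe s₁ ready₁ 1≤W 1≤W

        galloped : Galloped (probed s₁ (proj₁ attempt)) 0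
        galloped = run-gallop (suc n) (probed s₁ (proj₁ attempt)) 0 (m≤m+n (suc n) 0) (ready-probed s₁ (proj₁ attempt) ready₁)
          refl refl o₀ (proj₂ (proj₂ attempt))

        open Galloped galloped using (rounds)

        s₂ s₃ : State 8
        s₂ = Galloped.state galloped

        D≤1+n : regs s₂ rD ≤ suc n
        D≤1+n = subst (_≤ suc n) (trans (Galloped.E≡ galloped) (sym (Galloped.D≡ galloped))) (s≤s (occurs-≤ (Galloped.found galloped)))

        D≤W : regs s₂ rD ≤ W
        D≤W = ≤-trans D≤1+n (m+n≤o⇒n≤o n n≤W)

        bisected : Bisected (setReg rY (regs s₂ rD ∸ 1) s₂) (rounds + 0)
        bisected = run-bisect (rounds + 0) (setReg rY (regs s₂ rD ∸ 1) s₂) (Galloped.ready galloped) (Galloped.D≡ galloped) D≤1+n refl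
          (Galloped.found galloped) (Galloped.bounded galloped)

        s₃ = Bisected.state bisected

        E≤W : regs s₃ rE ≤ W
        E≤W = ≤-trans (occurs-≤ (Bisected.found bisected)) (m+n≤o⇒m≤o n n≤W)

        queries≡ : ∀ i → 1 + (i + (i + 0 + 0)) ≡ 1 + (i + i)
        queries≡ = solve-∀

        time≡ : ∀ i → 7 + (i * 6 + 1 + (1 + ((i + 0) * 8 + 1 + 1))) ≡ 14 * i + 11
        time≡ = solve-∀

  -- Committing a run and opening the next slot.

  record Extended (P : Program 8) (s : State 8) (p : ℕ) (L R : String) : Set where
    field
      {state}   : State 8
      {time′}   : ℕ
      execution : Runs P s state 0 time′
      time≤     : time′ ≤ 4
      layout    : Layout state (3 + p) L R
      empty     : mem state (5 + p) ≡ 0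
      σ≡        : regs state rσ ≡ regs s rσ

  run-extendʳ : ∀ {s p L c e} → Layout s p L [] → mem s (1 + p) ≡ c → mem s (2 + p) ≡ e → 6 + p < M → 6 + p ≤ W →
    Extended extendʳ s p (L ++ power (c , e) ++ []) []
  run-extendʳ {s} {p} {L} {c} {e} l c≡ e≡ p<M p≤W = record
    { execution = run-set (≤-trans (≤-reflexive X≡) (≤-trans (m≤n+m (3 + p) 3) p≤W))
                ⨟ run-set (≤-trans (≤-reflexive A≡) (≤-trans (m≤n+m (4 + p) 2) p≤W))
                ⨟ run-store X≡ (≤-trans (m≤n+m (4 + p) 3) p<M) (≤-trans (≤-reflexive A≡) (≤-trans (m≤n+m (4 + p) 2) p≤W))
    ; time≤     = n≤1+n 3
    ; layout    = record
      { slot   = A≡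
      ; before = path-++ (path-agree (m≤n+m (suc p) 3) (λ a lt → unchanged a (<⇒≢ (m≤n⇒m≤1+n (m≤n⇒m≤1+n lt)))) before)
                   (node ≤-refl (trans (unchanged (1 + p) (λ ())) c≡) (trans (unchanged (2 + p) (λ ())) e≡) next≡ [])
      -- The next pointer of the new slot lies in untouched memory, so it is 0 and ends the list.
      ; after  = subst (λ q → Path m (4 + p) q [] 0) (sym (cleared (6 + p) (m≤n+m (4 + p) 2))) []
      ; fresh  = λ a lt → cleared a (m+n≤o⇒n≤o 3 lt)
      }
    ; empty     = cleared (5 + p) (m≤n+m (4 + p) 1)
    ; σ≡        = refl
    }
    where
    open Layout l
    X = regs s rA + 2
    A = regs s rA + 3
    m = write X A (mem s)

    X≡ : X ≡ 3 + p
    X≡ = trans (cong (_+ 2) slot) (+-comm (suc p) 2)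

    A≡ : A ≡ 4 + p
    A≡ = trans (cong (_+ 3) slot) (+-comm (suc p) 3)

    unchanged : ∀ a → a ≢ 3 + p → m a ≡ mem s a
    unchanged a a≢ = write-other A (mem s) (λ a≡ → a≢ (trans a≡ X≡))

    next≡ : m (3 + p) ≡ 4 + p
    next≡ = trans (cong m (sym X≡)) (trans (write-same X A (mem s)) A≡)

    cleared : ∀ a → 3 + p < a → m a ≡ 0
    cleared a lt = trans (unchanged a (>⇒≢ lt)) (fresh a lt)

  run-extendˡ : ∀ {s p L R c e} → Layout s p L R → mem s (1 + p) ≡ c → mem s (2 + p) ≡ e → 6 + p < M → 6 + p ≤ W →
    Extended extendˡ s p [] (L ++ power (c , e) ++ R)
  run-extendˡ {s} {p} {L} {R} {c} {e} l c≡ e≡ p<M p≤W = record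
    { execution = run-set (≤-trans (≤-reflexive A≡) A≤W)
                ⨟ run-set (≤-trans (≤-reflexive X≡) p≤W)
                ⨟ run-store X≡ p<M H≤W
                ⨟ run-set (≤-trans (≤-reflexive H≡) A≤W)
    ; time≤     = ≤-refl
    ; layout    = record
      { slot   = A≡
      ; before = subst (λ h → Path m (4 + p) h [] (4 + p)) (sym H≡) []
      ; after  = subst (λ q → Path m (4 + p) q _ 0) (sym next≡)
                   (layout-path l (λ a a≤p → unchanged a (<⇒≢ (s≤s (≤-trans a≤p (m≤n+m p 5)))))
                     (trans (unchanged (1 + p) (λ ())) c≡) (trans (unchanged (2 + p) (λ ())) e≡) (unchanged (3 + p) (λ ())))
      ; fresh  = λ a lt → trans (unchanged a (>⇒≢ lt)) (fresh a (m+n≤o⇒n≤o 3 lt))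
      }
    ; empty     = trans (unchanged (5 + p) (λ ())) (fresh (5 + p) (m≤n+m (4 + p) 1))
    ; σ≡        = refl
    }
    where
    open Layout l
    A = regs s rA + 3
    X = A + 2
    m = write X (regs s rH) (mem s)

    A≡ : A ≡ 4 + p
    A≡ = trans (cong (_+ 3) slot) (+-comm (suc p) 3)

    X≡ : X ≡ 6 + p
    X≡ = trans (cong (_+ 2) A≡) (+-comm (4 + p) 2)

    H≡ : A + 0 ≡ 4 + p
    H≡ = trans (+-identityʳ A) A≡

    A≤W : 4 + p ≤ W
    A≤W = ≤-trans (m≤n+m (4 + p) 2) p≤W

    H≤W : regs s rH ≤ W
    H≤W = ≤-trans (path-start ≤-refl before) (≤-trans (m≤n+m (1 + p) 5) p≤W)

    unchanged : ∀ a → a ≢ 6 + p → m a ≡ mem s a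
    unchanged a a≢ = write-other (regs s rH) (mem s) (λ a≡ → a≢ (trans a≡ X≡))

    next≡ : m (6 + p) ≡ regs s rH
    next≡ = trans (cong m (sym X≡)) (write-same X (regs s rH) (mem s))

-- Estimates for logarithms.

n<2^n : ∀ n → n < 2 ^ n
n<2^n zero    = s≤s z≤n
n<2^n (suc n) = ≤-trans (+-mono-≤ (m^n>0 2 n) (n<2^n n)) (≤-reflexive (2^+2^ n))

-- A linear bound on the logarithm in place of its concavity.
log-linear : ∀ K i {x} → 2 ^ i ≤ x → i * 2 ^ K ≤ K * 2 ^ K + x
log-linear K i {x} 2^i≤x with ≤-total i K
... | inj₁ i≤K = m≤n⇒m≤n+o x (*-monoˡ-≤ (2 ^ K) i≤K)
... | inj₂ K≤i with d , refl ← m≤n⇒∃[o]m+o≡n K≤i = begin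
  (K + d) * 2 ^ K         ≡⟨ *-distribʳ-+ (2 ^ K) K d ⟩
  K * 2 ^ K + d * 2 ^ K   ≤⟨ +-monoʳ-≤ (K * 2 ^ K) (*-monoˡ-≤ (2 ^ K) (<⇒≤ (n<2^n d))) ⟩
  K * 2 ^ K + 2 ^ d * 2 ^ K ≡⟨ cong (K * 2 ^ K +_) (trans (*-comm (2 ^ d) (2 ^ K)) (sym (^-distribˡ-+-* 2 K d))) ⟩
  K * 2 ^ K + 2 ^ (K + d) ≤⟨ +-monoʳ-≤ (K * 2 ^ K) 2^i≤x ⟩
  K * 2 ^ K + x           ∎
  where open ≤-Reasoning

n<2^[1+log₂n] : ∀ n → n < 2 ^ suc ⌊log₂ n ⌋
n<2^[1+log₂n] n = ≰⇒> λ le → 1+n≰n (≤-trans (≤-reflexive (sym (⌊log₂[2^n]⌋≡n (suc ⌊log₂ n ⌋)))) (⌊log₂⌋-mono-≤ le))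

-- A common interface for the two directions.

record Direction (S : String) : Set₁ where
  field
    extend      : Program 8
    base        : ℕ
    Inv         : List Run → Set
    left right  : List Run → String
    grow        : List Run → Run → List Run
    occurs      : ∀ {rs} → Inv rs → left rs ++ right rs ⊑ S
    rle-bound   : ∀ {rs} → Inv rs → length rs ≤ rle S
    inv-grow    : ∀ {rs c e} → Inv rs → left rs ++ replicate (suc e) c ++ right rs ⊑ S →
                  ¬ (left rs ++ replicate (2 + e) c ++ right rs ⊑ S) → Inv (grow rs (c , suc e))
    length-grow : ∀ rs r → length (grow rs r) ≡ suc (length rs)
    cat-split   : ∀ rs → cat rs ≡ left rs ++ right rs
    cat-grow    : ∀ rs r → cat (grow rs r) ≡ left rs ++ power r ++ right rs
    base≤       : base ≤ 3
    run-extend  : ∀ {M W s p c e} rs → Layout s p (left rs) (right rs) → mem s (1 + p) ≡ c → mem s (2 + p) ≡ e →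
                  6 + p < M → 6 + p ≤ W → Machine.Extended S M W extend s p (left (grow rs (c , e))) (right (grow rs (c , e)))

rightward : ∀ S → Direction S
rightward S = record
  { extend      = extendʳ
  ; base        = 0
  ; Inv         = Rightward S
  ; left        = cat
  ; right       = λ _ → []
  ; grow        = _∷ʳ_
  ; occurs      = λ {rs} inv → subst (_⊑ S) (sym (++-identityʳ (cat rs))) (Rightward.occurs inv)
  ; rle-bound   = λ inv → ≤-trans (≤-reflexive (cong length (sym (runs-cat (Rightward.isRunList inv))))) (rle-mono (Rightward.occurs inv))
  ; inv-grow    = rightward-∷ʳ
  ; length-grow = λ rs r → trans (length-++ rs) (+-comm (length rs) 1)
  ; cat-split   = λ rs → sym (++-identityʳ (cat rs))
  ; cat-grow    = cat-∷ʳ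
  ; base≤       = z≤n
  ; run-extend  = λ {M} {W} {s} {p} rs l c≡ e≡ p<M p≤W →
      subst (λ L → Machine.Extended S M W extendʳ s p L []) (sym (cat-∷ʳ rs _)) (Machine.run-extendʳ S M W l c≡ e≡ p<M p≤W)
  }

leftward : ∀ S → Direction S
leftward S = record
  { extend      = extendˡ
  -- The first slot of this phase lies one node beyond the spare slot that the rightward phase
  -- leaves behind.
  ; base        = 3
  ; Inv         = Leftward S
  ; left        = λ _ → []
  ; right       = cat
  ; grow        = λ rs r → r ∷ rs
  ; occurs      = Leftward.occurs
  ; rle-bound   = λ inv → ≤-trans (≤-reflexive (cong length (sym (runs-cat (Leftward.isRunList inv))))) (rle-mono (Leftward.occurs inv))
  ; inv-grow    = leftward-∷
  ; length-grow = λ _ _ → refl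
  ; cat-split   = λ _ → refl
  ; cat-grow    = λ _ _ → refl
  ; base≤       = ≤-refl
  ; run-extend  = λ rs → Machine.run-extendˡ S _ _
  }

-- The scan in one direction and its amortised cost.

module Scan (S : String) (σ M W : ℕ) (direction : Direction S)
  (r≤M : 10 + 3 * rle S ≤ M) (M≤W : M ≤ W) (n≤W : length S + suc (length S) ≤ W) (σ≤W : σ ≤ W) where

  open Direction direction
  open Machine S M W

  private
    n = length S

  -- A potential, scaled by `2 ^ K` to avoid fractions. A run pays `σ` for resetting the character
  -- counter and `1 + 2 * K` towards its search; the excess of its two logarithms over `K` is
  -- charged to its letters, at 4 each.
  weight : ℕ → List Run → ℕ
  weight K rs = length rs * ((2 * K + 1 + σ) * 2 ^ K) + 4 * length (cat rs)

  record Config (s : State 8) (rs : List Run) : Set where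
    field
      {p}    : ℕ
      p≡     : p ≡ base + 3 * length rs
      inv    : Inv rs
      layout : Layout s p (left rs) (right rs)
      empty  : mem s (2 + p) ≡ 0
      σ≡     : regs s rσ ≡ σ

  Blocked : List Run → Char → Set
  Blocked rs x = ¬ (left rs ++ x ∷ right rs ⊑ S)

  config-C : ∀ {s rs} v → Config s rs → Config (setReg rC v s) rs
  config-C v k = record { Config k ; layout = record { Layout (Config.layout k) } }

  -- `K` remains free here and is chosen at the end from `n` and `rle S`. `c≤q` later provides the
  -- positive number of queries that absorbs the constant part of the running time.
  record Scanned (P : Program 8) (s : State 8) (c : ℕ) (rs : List Run) : Set where
    field
      {state}   : State 8
      {runList} : List Run
      {q t}     : ℕ
      execution : Runs P s state q t
      config    : Config state runList
      blocked   : ∀ x → 0 < x → x ≤ σ → Blocked runList x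
      c≤q       : c ≤ q
      t≤        : t ≤ 18 * q + 1
      amortised : ∀ K → q * 2 ^ K + weight K rs ≤ c * 2 ^ K + weight K runList

  -- A round with `i` doublings asks `1 + 2 * i` queries, so 18 steps per query cover its time with
  -- `22 * i` to spare.
  time-bound : ∀ i q {t t′} → t ≤ 14 * i + 18 → t′ ≤ 18 * q + 1 → t + t′ ≤ 18 * (1 + (i + i) + q) + 1
  time-bound i q le le′ = ≤-trans (+-mono-≤ le le′) (≤-trans (m≤m+n _ (22 * i)) (≤-reflexive (identity i q)))
    where
    identity : ∀ i q → 14 * i + 18 + (18 * q + 1) + 22 * i ≡ 18 * (1 + (i + i) + q) + 1
    identity = solve-∀

  -- A successful search of 1 + 2i queries is paid for by the new run of length e.
  amortise : ∀ K i e q c w w′ → 2 ^ i ≤ suc (suc e) →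
    q * 2 ^ K + (w + ((2 * K + 1 + σ) * 2 ^ K + 4 * suc e)) ≤ σ * 2 ^ K + w′ →
    (1 + (i + i) + q) * 2 ^ K + w ≤ c * 2 ^ K + w′
  amortise K i e q c w w′ 2^i≤ ih = ≤-trans (+-cancelʳ-≤ x _ _ (begin
    (1 + (i + i) + q) * P + w + x
      ≡⟨ identity₁ i q K P σ w (suc e) ⟩
    (i * P + i * P) + (P + (q * P + (w + x)))
      ≤⟨ +-mono-≤ (+-mono-≤ iP≤ iP≤) (+-monoʳ-≤ P ih) ⟩
    ((K * P + 2 * suc e) + (K * P + 2 * suc e)) + (P + (σ * P + w′))
      ≡⟨ identity₂ K P σ w′ (suc e) ⟩
    w′ + x ∎)) (m≤n+m w′ (c * P))
    where
    open ≤-Reasoning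
    P = 2 ^ K
    x = (2 * K + 1 + σ) * P + 4 * suc e

    iP≤ : i * P ≤ K * P + 2 * suc e
    iP≤ = log-linear K i (≤-trans 2^i≤ (s≤s (≤-trans (≤-reflexive (+-comm 1 e)) (+-monoʳ-≤ e (s≤s z≤n)))))

    identity₁ : ∀ i q K P σ w e → (1 + (i + i) + q) * P + w + ((2 * K + 1 + σ) * P + 4 * e)
      ≡ (i * P + i * P) + (P + (q * P + (w + ((2 * K + 1 + σ) * P + 4 * e))))
    identity₁ = solve-∀

    identity₂ : ∀ K P σ w e → ((K * P + 2 * e) + (K * P + 2 * e)) + (P + (σ * P + w)) ≡ w + ((2 * K + 1 + σ) * P + 4 * e)
    identity₂ = solve-∀

  length-cat-grow : ∀ rs r → length (cat (grow rs r)) ≡ proj₂ r + length (cat rs)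
  length-cat-grow rs r@(c , e) rewrite cat-grow rs r | cat-split rs
    | length-++ (left rs) {power r ++ right rs} | length-++ (power r) {right rs} | length-++ (left rs) {right rs} | length-replicate e {c}
    = identity (length (left rs)) e (length (right rs))
    where
    identity : ∀ l e r → l + (e + r) ≡ e + (l + r)
    identity = solve-∀

  weight-grow : ∀ K rs r → weight K (grow rs r) ≡ weight K rs + ((2 * K + 1 + σ) * 2 ^ K + 4 * proj₂ r)
  weight-grow K rs r rewrite length-grow rs r | length-cat-grow rs r =
    identity (length rs) (length (cat rs)) ((2 * K + 1 + σ) * 2 ^ K) (proj₂ r)
    where
    identity : ∀ l n b e → (1 + l) * b + 4 * (e + n) ≡ l * b + 4 * n + (b + 4 * e)
    identity = solve-∀

  cat-length≤ : ∀ {rs} → Inv rs → length (cat rs) ≤ n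
  cat-length≤ {rs} inv = ≤-trans (≤-reflexive (cong length (cat-split rs))) (Infixₚ.length-mono (occurs inv))

  -- Lexicographic recursion: a failure lowers `c`; a success resets `c` to `σ` but lowers `a`, a
  -- bound on the number of letters still missing.
  run-scan : ∀ a c {s rs} → Config s rs → n ≤ a + length (cat rs) → regs s rC ≡ c → c ≤ σ →
    (∀ x → c < x → x ≤ σ → Blocked rs x) → Scanned (scan extend) s c rs
  run-scan a zero k n≤ C≡ c≤σ blk = record
    { execution = run-done C≡ ; config = k ; blocked = blk ; c≤q = z≤n ; t≤ = s≤s z≤n ; amortised = λ K → ≤-refl }
  run-scan a (suc c) {s} {rs} k n≤ C≡ c≤σ blk = continue (regs s₁ rE) refl
    where
    open Config k

    -- `6 + p` is the last cell of the next slot. With `base` at most 3 and three cells per run,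
    -- this explains `10 + 3 * rle S`.
    p-bound : 6 + p < M
    p-bound = ≤-trans (+-monoʳ-≤ 7 (≤-trans (≤-reflexive p≡) (+-mono-≤ base≤ (*-monoʳ-≤ 3 (rle-bound inv))))) r≤M

    p≤W : 6 + p ≤ W
    p≤W = ≤-trans (<⇒≤ p-bound) M≤W

    C≤W : regs s rC ≤ W
    C≤W = ≤-trans (≤-reflexive C≡) (≤-trans c≤σ σ≤W)

    module Sr = Search s layout (≤-trans (m≤n+m (3 + p) 4) p-bound) (≤-trans (m≤n+m (2 + p) 4) p≤W) C≤W n≤W

    searched : Sr.Searched
    searched = Sr.run-search (occurs inv)

    open Sr.Searched searched using (rounds; ready; found; bounded; 2^rounds≤) renaming (state to s₁; execution to run₁; E≡ to e≡)

    layout₁ : Layout s₁ p (left rs) (right rs)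
    layout₁ = Sr.ready-layout s₁ ready

    σ≡₁ : regs s₁ rσ ≡ σ
    σ≡₁ = trans (proj₁ ready) σ≡

    C≡₁ : regs s₁ rC ≡ suc c
    C≡₁ = trans (proj₁ (proj₂ (proj₂ (proj₂ ready)))) C≡

    char≡ : mem s₁ (1 + p) ≡ regs s rC
    char≡ = proj₁ (proj₂ (proj₂ (proj₂ (proj₂ (proj₂ ready)))))

    C≢0 : regs s rC ≢ 0
    C≢0 C≡0 = 0≢1+n (trans (sym C≡0) C≡)

    continue : ∀ e → regs s₁ rE ≡ e → Scanned (scan extend) s (suc c) rs
    continue zero E≡0 = record
      { execution = recount (cong (_+ q) (+-identityʳ _)) refl
          (run-loop C≢0 (run₁ ⨟ run-else E≡0 (run-set (≤-trans (m∸n≤m _ 1) (≤-trans (≤-reflexive C≡₁) (≤-trans c≤σ σ≤W))))) execution)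
      ; config    = config
      ; blocked   = blocked
      ; c≤q       = s≤s (≤-trans c≤q (m≤n+m q _))
      ; t≤        = time-bound rounds q (≤-trans (≤-reflexive (time≡ rounds)) (+-monoʳ-≤ (14 * rounds) (m≤n+m 14 4))) t≤
      ; amortised = λ K → ≤-trans (≤-reflexive (trans (cong (λ i → (1 + (i + i) + q) * 2 ^ K + weight K rs) rounds≡0) (+-assoc (2 ^ K) _ _)))
          (≤-trans (+-monoʳ-≤ (2 ^ K) (amortised K)) (≤-reflexive (sym (+-assoc (2 ^ K) _ _))))
      }
      where
      s₂ : State 8
      s₂ = setReg rC (regs s₁ rC ∸ 1) s₁

      ¬c : Blocked rs (suc c)
      ¬c o = bounded (subst (λ e → Sr.Occurs (suc e)) (sym E≡0) (subst (λ d → left rs ++ d ∷ right rs ⊑ S) (sym C≡) o))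

      blk′ : ∀ x → c < x → x ≤ σ → Blocked rs x
      blk′ x c<x x≤σ with m≤n⇒m<n∨m≡n c<x
      ... | inj₁ lt   = blk x lt x≤σ
      ... | inj₂ refl = ¬c

      config₂ : Config s₂ rs
      config₂ = config-C _ (record { p≡ = p≡ ; inv = inv ; layout = layout₁ ; empty = trans e≡ E≡0 ; σ≡ = σ≡₁ })

      -- A failing character costs a single query, which the decrease of the counter pays for.
      rounds≡0 : rounds ≡ 0
      rounds≡0 = n≤0⇒n≡0 (≤-pred (≤-trans (n<2^n rounds) (≤-trans 2^rounds≤ (≤-reflexive (cong suc E≡0)))))

      time≡ : ∀ i → suc (14 * i + 11 + 2) ≡ 14 * i + 14
      time≡ = solve-∀

      open Scanned (run-scan a c config₂ n≤ (cong (_∸ 1) C≡₁) (≤-trans (n≤1+n c) c≤σ) blk′)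
    continue (suc e) E≡ = advance a n≤
      where
      r : Run
      r = regs s rC , suc e

      inv₂ : Inv (grow rs r)
      inv₂ = inv-grow inv (subst Sr.Occurs E≡ found) (subst (λ e → ¬ Sr.Occurs (suc e)) E≡ bounded)

      extended : Extended extend s₁ p (left (grow rs r)) (right (grow rs r))
      extended = run-extend rs layout₁ char≡ (trans e≡ E≡) p-bound p≤W

      open Extended extended renaming (state to s₂; execution to run₂; layout to layout₂; empty to empty₂; σ≡ to σ≡₂)

      s₃ : State 8
      s₃ = setReg rC (regs s₂ rσ + 0) s₂

      config₃ : Config s₃ (grow rs r)
      config₃ = config-C _ (record
        { p≡ = trans (cong (3 +_) p≡) (trans (identity base (length rs)) (cong (λ l → base + 3 * l) (sym (length-grow rs r))))
        ; inv = inv₂ ; layout = layout₂ ; empty = empty₂ ; σ≡ = trans σ≡₂ σ≡₁ })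
        where
        identity : ∀ b l → 3 + (b + 3 * l) ≡ b + 3 * (1 + l)
        identity = solve-∀

      C≡₃ : regs s₂ rσ + 0 ≡ σ
      C≡₃ = trans (+-identityʳ _) (trans σ≡₂ σ≡₁)

      advance : ∀ a → n ≤ a + length (cat rs) → Scanned (scan extend) s (suc c) rs
      -- Here `rs` already spells `n` letters, but the grown list would spell more and still occur
      -- in `S`.
      advance zero    n≤ = ⊥-elim (<⇒≱ (s≤s (m≤n+m (length (cat rs)) e))
        (≤-trans (≤-reflexive (sym (length-cat-grow rs r))) (≤-trans (cat-length≤ inv₂) n≤)))
      advance (suc a) n≤ = record
        { execution = recount (cong (_+ q) (+-identityʳ _)) refl
            (run-loop C≢0 (run₁ ⨟ run-then (λ E≡0 → 0≢1+n (trans (sym E≡0) E≡))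
              (run₂ ⨟ run-set (≤-trans (≤-reflexive C≡₃) σ≤W))) execution)
        ; config    = config
        ; blocked   = blocked
        ; c≤q       = ≤-trans c≤σ (≤-trans c≤q (m≤n+m q _))
        ; t≤        = time-bound rounds q (≤-trans (≤-reflexive (time≡ rounds time′))
            (+-monoʳ-≤ (14 * rounds) (+-monoʳ-≤ 14 time≤))) t≤
        ; amortised = λ K → amortise K rounds e q (suc c) (weight K rs) (weight K runList) (subst (λ e → 2 ^ rounds ≤ suc e) E≡ 2^rounds≤)
            (subst (λ w → q * 2 ^ K + w ≤ σ * 2 ^ K + weight K runList) (weight-grow K rs r) (amortised K))
        }
        where
        time≡ : ∀ i t → suc (14 * i + 11 + suc (t + 1)) ≡ 14 * i + (14 + t)
        time≡ = solve-∀

        n≤′ : n ≤ a + length (cat (grow rs r))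
        n≤′ = ≤-trans n≤ (≤-trans (≤-reflexive (sym (+-suc a _))) (+-monoʳ-≤ a
          (≤-trans (s≤s (m≤n+m _ e)) (≤-reflexive (sym (length-cat-grow rs r))))))

        open Scanned (run-scan a σ config₃ n≤′ C≡₃ ≤-refl (λ x σ<x x≤σ → ⊥-elim (<⇒≱ σ<x x≤σ)))

  run-phase : ∀ {s rs} → Config s rs → Σ[ r ∈ Scanned (scan extend) (setReg rC (regs s rσ + 0) s) σ rs ]
    Runs (phase extend) s (Scanned.state r) (Scanned.q r) (suc (Scanned.t r))
  run-phase {s} {rs} k = r , (run-set (≤-trans (≤-reflexive C≡) σ≤W) ⨟ Scanned.execution r)
    where
    C≡ : regs s rσ + 0 ≡ σ
    C≡ = trans (+-identityʳ _) (Config.σ≡ k)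
    r : Scanned (scan extend) (setReg rC (regs s rσ + 0) s) σ rs
    r = run-scan n σ (config-C _ k) (m≤m+n n _) C≡ ≤-refl (λ x σ<x x≤σ → ⊥-elim (<⇒≱ σ<x x≤σ))

-- The query bound in closed form.

rle-≤-length : ∀ s → rle s ≤ length s
rle-≤-length []      = z≤n
rle-≤-length (c ∷ s) = ≤-trans (prepend-≤ (runs s)) (s≤s (rle-≤-length s))
  where
  prepend-≤ : ∀ rs → length (prepend c rs) ≤ suc (length rs)
  prepend-≤ [] = s≤s z≤n
  prepend-≤ ((d , _) ∷ rs) with c ≟ d
  ... | yes _ = n≤1+n _
  ... | no  _ = ≤-refl

-- The reason for choosing `K` as `suc ⌊log₂ (n / r) ⌋`: after division by `2 ^ K`, the charge of 4
-- per letter amounts to at most 4 per run.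
n≤2^*r : ∀ n r .{{_ : NonZero r}} → n ≤ r * 2 ^ suc ⌊log₂ (n / r) ⌋
n≤2^*r n r = begin
  n                                ≡⟨ m≡m%n+[m/n]*n n r ⟩
  n % r + n / r * r                ≤⟨ +-monoˡ-≤ (n / r * r) (<⇒≤ (m%n<n n r)) ⟩
  suc (n / r) * r                  ≤⟨ *-monoˡ-≤ r (n<2^[1+log₂n] (n / r)) ⟩
  2 ^ suc ⌊log₂ (n / r) ⌋ * r      ≡⟨ *-comm (2 ^ suc ⌊log₂ (n / r) ⌋) r ⟩
  r * 2 ^ suc ⌊log₂ (n / r) ⌋      ∎
  where open ≤-Reasoning

-- The second phase starts from the run list where the first one ends, so its weight `w` cancels.
-- Dividing by `P` leaves `2 * σ + r * (σ + 2 * L) + 7 * r`, and positivity of `r` and `σ` absorbs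
-- the lower terms.
query-bound : ∀ q₁ q₂ σ n r w L → 1 ≤ σ → 1 ≤ r → n ≤ r * 2 ^ suc L →
  q₁ * 2 ^ suc L + 0 ≤ σ * 2 ^ suc L + w →
  q₂ * 2 ^ suc L + w ≤ σ * 2 ^ suc L + (r * ((2 * suc L + 1 + σ) * 2 ^ suc L) + 4 * n) →
  q₁ + q₂ ≤ 10 * (r * (σ + L))
query-bound q₁ q₂ σ n r w L 1≤σ 1≤r n≤ le₁ le₂ =
  ≤-trans (*-cancelʳ-≤ _ _ P {{m^n≢0 2 (suc L)}} (+-cancelʳ-≤ w _ _ (begin
    (q₁ + q₂) * P + w
      ≡⟨ identity₁ q₁ q₂ P w ⟩
    (q₁ * P + 0) + (q₂ * P + w)
      ≤⟨ +-mono-≤ le₁ le₂ ⟩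
    (σ * P + w) + (σ * P + (r * ((2 * suc L + 1 + σ) * P) + 4 * n))
      ≤⟨ +-monoʳ-≤ (σ * P + w) (+-monoʳ-≤ (σ * P) (+-monoʳ-≤ (r * ((2 * suc L + 1 + σ) * P)) (*-monoʳ-≤ 4 n≤))) ⟩
    (σ * P + w) + (σ * P + (r * ((2 * suc L + 1 + σ) * P) + 4 * (r * P)))
      ≡⟨ identity₂ σ P w r L ⟩
    (1 * (2 * σ) + r * (σ + 2 * L) + (r * 1) * 7) * P + w ∎))) (begin
  1 * (2 * σ) + r * (σ + 2 * L) + (r * 1) * 7
    ≤⟨ +-mono-≤ (+-monoˡ-≤ (r * (σ + 2 * L)) (*-monoˡ-≤ (2 * σ) 1≤r)) (*-monoˡ-≤ 7 (*-monoʳ-≤ r 1≤σ)) ⟩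
  r * (2 * σ) + r * (σ + 2 * L) + (r * σ) * 7
    ≤⟨ m≤m+n _ (8 * (r * L)) ⟩
  r * (2 * σ) + r * (σ + 2 * L) + (r * σ) * 7 + 8 * (r * L)
    ≡⟨ identity₃ σ r L ⟩
  10 * (r * (σ + L)) ∎)
  where
  open ≤-Reasoning
  P = 2 ^ suc L

  identity₁ : ∀ q₁ q₂ P w → (q₁ + q₂) * P + w ≡ (q₁ * P + 0) + (q₂ * P + w)
  identity₁ = solve-∀

  identity₂ : ∀ σ P w r L → (σ * P + w) + (σ * P + (r * ((2 * suc L + 1 + σ) * P) + 4 * (r * P)))
    ≡ (1 * (2 * σ) + r * (σ + 2 * L) + (r * 1) * 7) * P + w
  identity₂ = solve-∀

  identity₃ : ∀ σ r L → r * (2 * σ) + r * (σ + 2 * L) + (r * σ) * 7 + 8 * (r * L) ≡ 10 * (r * (σ + L))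
  identity₃ = solve-∀

-- Both phases together and the final bounds.

module Reconstruction (σ : ℕ) (S : String) (alphabet : All (InAlphabet σ) S) .{{nonempty : NonZero (rle S)}} where

  private
    n = length S
    r = rle S
    M = 10 + 3 * r
    -- The summands bound addresses, probed exponents and characters, respectively.
    W = M + (n + suc n) + σ

  1≤r : 1 ≤ r
  1≤r = >-nonZero⁻¹ r

  1≤σ : 1 ≤ σ
  1≤σ = positive alphabet 1≤r
    where
    positive : ∀ {s} → All (InAlphabet σ) s → 1 ≤ rle s → 1 ≤ σ
    positive ((1≤c , c≤σ) ∷ _) _ = ≤-trans 1≤c c≤σ

  M≤W : M ≤ W
  M≤W = ≤-trans (m≤m+n M (n + suc n)) (m≤m+n _ σ)

  n≤W : n + suc n ≤ W
  n≤W = ≤-trans (m≤n+m (n + suc n) M) (m≤m+n _ σ)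

  σ≤W : σ ≤ W
  σ≤W = m≤n+m σ _

  1≤W : 1 ≤ W
  1≤W = ≤-trans (s≤s z≤n) M≤W

  module Right = Scan S σ M W (rightward S) ≤-refl M≤W n≤W σ≤W
  module Left  = Scan S σ M W (leftward S) ≤-refl M≤W n≤W σ≤W
  open Machine S M W

  s₀ s₁ : State 8
  s₀ = initial 7 σ
  s₁ = setReg rA 1 (setReg rH 1 s₀)

  config₁ : Right.Config s₁ []
  config₁ = record
    { p≡ = refl ; inv = rightward-[] S ; empty = refl ; σ≡ = refl
    ; layout = record { slot = refl ; before = [] ; after = [] ; fresh = λ _ _ → refl }
    }

  record Result : Set where
    field
      {state}   : State 8
      {q t}     : ℕ
      execution : Runs reconstruct s₀ state q t
      output    : Spells (mem state) (regs state rσ) S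
      q≤        : q ≤ 10 * (r * (σ + ⌊log₂ (n / r) ⌋))
      t≤        : t ≤ 29 * q

  result : Result
  result with Right.run-phase config₁
  ... | scanned₁ , run₁ = after-right
    where
    open Right.Scanned scanned₁ using () renaming
      (state to s₂; runList to rs; q to q₁; t to t₁; config to config₂; blocked to blocked₁; t≤ to t₁≤; amortised to amortised₁)
    open Right.Config config₂ using (p; p≡; inv; layout; empty; σ≡)

    -- The scan has excluded the characters from 1 to `σ`; any other `x` cannot occur in `S` at all.
    ¬snoc : ∀ x → ¬ (cat rs ∷ʳ x ⊑ S)
    ¬snoc x o with Allₚ.++⁻ʳ (cat rs) (⊑-All o alphabet)
    ... | (0<x , x≤σ) ∷ [] = blocked₁ x 0<x x≤σ o

    p-bound : 6 + p < M
    p-bound = +-monoʳ-≤ 7 (≤-trans (≤-reflexive p≡) (≤-trans (*-monoʳ-≤ 3 (Direction.rle-bound (rightward S) inv)) (m≤n+m (3 * r) 3)))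

    extended : Extended extendˡ s₂ p [] (cat rs ++ [] ++ [])
    extended = run-extendˡ layout refl empty p-bound (≤-trans (<⇒≤ p-bound) M≤W)

    open Extended extended using () renaming (state to s₃; execution to run₂; time′ to t₂; time≤ to t₂≤; layout to layout₃; empty to empty₃; σ≡ to σ≡₃)

    config₃ : Left.Config s₃ rs
    config₃ = record
      { p≡ = cong (3 +_) p≡ ; inv = rightward⇒leftward inv ¬snoc ; empty = empty₃ ; σ≡ = trans σ≡₃ σ≡
      ; layout = subst (Layout s₃ (3 + p) []) (++-identityʳ (cat rs)) layout₃ }

    after-right : Result
    after-right with Left.run-phase config₃
    ... | scanned₃ , run₃ = record
      { execution = run-set 1≤W ⨟ run-set 1≤W ⨟ run₁ ⨟ run₂ ⨟ run₃ ⨟ run-set H≤W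
      ; output    = subst (λ h → Spells (mem s₄) h S) (sym (+-identityʳ _)) (subst (Spells (mem s₄) (regs s₄ rH)) (sym S≡) spelled)
      ; q≤        = ≤-trans (≤-reflexive (cong (q₁ +_) (+-identityʳ q₃))) (query-bound q₁ q₃ σ n r (Right.weight (suc ⌊log₂ (n / r) ⌋) rs) ⌊log₂ (n / r) ⌋ 1≤σ 1≤r (n≤2^*r n r)
          (amortised₁ (suc ⌊log₂ (n / r) ⌋))
          (≤-trans (amortised₃ (suc ⌊log₂ (n / r) ⌋)) (≤-reflexive (cong (σ * 2 ^ suc ⌊log₂ (n / r) ⌋ +_) weight≡))))
      ; t≤        = total
      }
      where
      open Left.Scanned scanned₃ using () renaming
        (state to s₄; runList to rs′; q to q₃; t to t₃; config to config₄; blocked to blocked₃; t≤ to t₃≤; c≤q to σ≤q₃; amortised to amortised₃)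
      open Left.Config config₄ using () renaming (p to p₄; p≡ to p₄≡; inv to inv₄; layout to layout₄; empty to empty₄)

      ¬cons : ∀ x → ¬ (x ∷ cat rs′ ⊑ S)
      ¬cons x o with ⊑-All o alphabet
      ... | (0<x , x≤σ) ∷ _ = blocked₃ x 0<x x≤σ o

      S≡ : S ≡ cat rs′
      S≡ = leftward-complete inv₄ ¬cons

      spelled : Spells (mem s₄) (regs s₄ rH) (cat rs′)
      spelled = path-spells (layout-path layout₄ (λ _ _ → refl) refl empty₄ refl)

      p₄-bound : 1 + p₄ ≤ M
      p₄-bound = s≤s (≤-trans (≤-reflexive p₄≡) (≤-trans (+-monoʳ-≤ 3 (*-monoʳ-≤ 3 (Direction.rle-bound (leftward S) inv₄))) (m≤n+m (3 + 3 * r) 6)))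

      H≤W : regs s₄ rH + 0 ≤ W
      H≤W = ≤-trans (≤-reflexive (+-identityʳ _)) (≤-trans (path-start ≤-refl (Layout.before layout₄)) (≤-trans p₄-bound M≤W))

      weight≡ : Left.weight (suc ⌊log₂ (n / r) ⌋) rs′ ≡ r * ((2 * suc ⌊log₂ (n / r) ⌋ + 1 + σ) * 2 ^ suc ⌊log₂ (n / r) ⌋) + 4 * n
      weight≡ = cong₂ (λ l k → l * ((2 * suc ⌊log₂ (n / r) ⌋ + 1 + σ) * 2 ^ suc ⌊log₂ (n / r) ⌋) + 4 * k)
        (trans (cong length (sym (runs-cat (Leftward.isRunList inv₄)))) (cong rle (sym S≡))) (cong length (sym S≡))

      -- The constant overhead of 11 steps is absorbed because `q₃` is at least `σ`, hence at least
      -- 1. Here `18 + 11` gives the constant 29.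
      total : 2 + (suc t₁ + (t₂ + (suc t₃ + 1))) ≤ 29 * (q₁ + (q₃ + 0))
      total = begin
        2 + (suc t₁ + (t₂ + (suc t₃ + 1)))
          ≤⟨ +-monoʳ-≤ 2 (+-mono-≤ (s≤s t₁≤) (+-mono-≤ t₂≤ (+-monoˡ-≤ 1 (s≤s t₃≤)))) ⟩
        2 + (suc (18 * q₁ + 1) + (4 + (suc (18 * q₃ + 1) + 1)))
          ≡⟨ identity₁ q₁ q₃ ⟩
        18 * q₁ + 18 * q₃ + 11 * 1
          ≤⟨ +-monoʳ-≤ (18 * q₁ + 18 * q₃) (*-monoʳ-≤ 11 (≤-trans 1≤σ (≤-trans σ≤q₃ (m≤n+m q₃ q₁)))) ⟩
        18 * q₁ + 18 * q₃ + 11 * (q₁ + q₃)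
          ≡⟨ identity₂ q₁ q₃ ⟩
        29 * (q₁ + (q₃ + 0)) ∎
        where
        open ≤-Reasoning
        identity₁ : ∀ a b → 2 + (suc (18 * a + 1) + (4 + (suc (18 * b + 1) + 1))) ≡ 18 * a + 18 * b + 11 * 1
        identity₁ = solve-∀
        identity₂ : ∀ a b → 18 * a + 18 * b + 11 * (a + b) ≡ 29 * (a + (b + 0))
        identity₂ = solve-∀

  space-bound : 8 + M ≤ 29 * r
  space-bound = begin
    18 * 1 + 3 * r          ≤⟨ +-monoˡ-≤ (3 * r) (*-monoʳ-≤ 18 1≤r) ⟩
    18 * r + 3 * r          ≤⟨ m≤m+n _ (8 * r) ⟩
    18 * r + 3 * r + 8 * r  ≡⟨ identity r ⟩
    29 * r                  ∎
    where
    open ≤-Reasoning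
    identity : ∀ r → 18 * r + 3 * r + 8 * r ≡ 29 * r
    identity = solve-∀

  word-bound : ∀ C → 5 ≤ C → W ≤ (n + σ) ^ C
  word-bound C 5≤C = begin
    10 + 3 * r + (n + suc n) + σ
      ≡⟨ identity₁ r n σ ⟩
    11 * 1 + 3 * r + 2 * n + σ
      ≤⟨ +-monoˡ-≤ σ (+-monoˡ-≤ (2 * n) (+-mono-≤ (*-monoʳ-≤ 11 1≤n) (*-monoʳ-≤ 3 r≤n))) ⟩
    11 * n + 3 * n + 2 * n + σ
      ≤⟨ m≤m+n _ (15 * σ) ⟩
    11 * n + 3 * n + 2 * n + σ + 15 * σ
      ≡⟨ identity₂ n σ ⟩
    (n + σ) * 2 ^ 4
      -- Since `n + σ` is at least 2, the factor 16 is bounded by four more powers of it.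
      ≤⟨ *-monoʳ-≤ (n + σ) (^-monoˡ-≤ 4 (+-mono-≤ 1≤n 1≤σ)) ⟩
    (n + σ) ^ 5
      ≤⟨ ^-monoʳ-≤ (n + σ) {{>-nonZero (≤-trans 1≤n (m≤m+n n σ))}} 5≤C ⟩
    (n + σ) ^ C ∎
    where
    open ≤-Reasoning
    r≤n : r ≤ n
    r≤n = rle-≤-length S
    1≤n : 1 ≤ n
    1≤n = ≤-trans 1≤r r≤n
    identity₁ : ∀ r n σ → 10 + 3 * r + (n + suc n) + σ ≡ 11 * 1 + 3 * r + 2 * n + σ
    identity₁ = solve-∀
    identity₂ : ∀ n σ → 11 * n + 3 * n + 2 * n + σ + 15 * σ ≡ (n + σ) * 16
    identity₂ = solve-∀

  reconstructs : Σ[ κ ∈ Cost ]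
    ( Reconstructs reconstruct σ S κ
    × queries κ ≤ 29 * (r * (σ + ⌊log₂ (n / r) ⌋))
    × time κ ≤ 29 * queries κ
    × space reconstruct κ ≤ 29 * r
    × word κ ≤ (n + σ) ^ 29 )
  reconstructs =
      cost _ _ cells′ word′
    , (state , exec , output)
    , ≤-trans q≤ (*-monoˡ-≤ (r * (σ + ⌊log₂ (n / r) ⌋)) (m≤m+n 10 19))
    , t≤
    , ≤-trans (+-monoʳ-≤ 8 cells≤) space-bound
    , ≤-trans word≤ (word-bound 29 (m≤m+n 5 24))
    where
    open Result result
    open Runs execution

theorem2 : ∃[ k ] Σ[ P ∈ Program (suc k) ] ∃[ C ]
    ∀ (σ : ℕ) (S : String) → All (InAlphabet σ) S → .{{_ : NonZero (rle S)}} →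
    Σ[ κ ∈ Cost ]
    ( Reconstructs P σ S κ
    × queries κ ≤ C * (rle S * (σ + ⌊log₂ (length S / rle S) ⌋))
    × time κ ≤ C * queries κ
    × space P κ ≤ C * rle S
    × word κ ≤ (length S + σ) ^ C )
theorem2 = 7 , reconstruct , 29 , λ σ S alphabet → Reconstruction.reconstructs σ S alphabet
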